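{- Let $m\ge 1$ be an integer and $0<\varepsilon\le 1$. For the problem $P_m|\varepsilon,\mathrm{online}|\sum p_j(1-U_j)$ (online maximization of total accepted processing time on $m$ parallel identical machines, without preemption, with immediate and irrevocable acceptance and allocation decisions, and slack factor $\varepsilon$) there is a deterministic online algorithm with strict competitive ratio at most $$m\cdot\left(\frac{1+\varepsilon}{\varepsilon}\right)^{\frac1m}+1.$$
   Context: Problem. There are $m$ parallel identical machines and a finite sequence $\mathcal{J}$ of jobs. Job $J_j$ has release (submission) date $r_j\ge 0$, processing time $p_j>0$ and deadline $d_j$ satisfying the slack condition $d_j-r_j\ge(1+\varepsilon)p_j$. The sequence is ordered so that $J_i$ precedes $J_j$ whenever $r_i<r_j$ (several jobs may have the same release date). Jobs are revealed in sequence order; job $J_j$ becomes known at time $r_j$, and the online algorithm must decide immediately, before seeing any later job of the sequence, whether to accept it ($U_j=0$) or reject it ($U_j=1$). If it accepts the job it must also immediately and irrevocably fix the machine and the starting time of the job. An accepted job is processed without interruption on a single machine, starting no earlier than $r_j$ and completing no later than $d_j$; a machine processes at most one job at a time. The objective is to maximize $\sum_j p_j(1-U_j)$. Let $\mathrm{ALG}(\mathcal{J})$ be the objective value of the online algorithm and $\mathrm{OPT}(\mathcal{J})$ the optimal offline value, i.e. the maximum total processing time of a subset of the jobs of $\mathcal{J}$ that has a non-preemptive schedule on $m$ machines in which every job of the subset is processed between its release date and its deadline. The algorithm has strict competitive ratio (at most) $c$ if $\mathrm{OPT}(\mathcal{J})\le c\cdot\mathrm{ALG}(\mathcal{J})$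 for every job sequence $\mathcal{J}$ satisfying the slack condition. -}

module Defs where

open import Algebra.Bundles using (CommutativeRing)
open import Algebra.Structures using (IsCommutativeRing)
import Algebra.Properties.Ring as RingProperties
import Algebra.Properties.Semiring.Exp as Exp
import Algebra.Properties.Semiring.Mult as Mult
import Algebra.Properties.Semiring.Sum as Sum
import Algebra.Solver.Ring.NaturalCoefficients.Default as Solver
open import Data.Empty using (⊥-elim)
open import Data.Fin.Base using (Fin; zero; suc; toℕ) renaming (_<_ to _<ᶠ_)
open import Data.List.Base using (List; length; lookup; take)
open import Data.Maybe.Base using (Maybe; just; nothing; maybe′)
open import Data.Nat.Base using (ℕ; zero; suc; NonZero)
open import Data.Product using (∃; ∃-syntax; _×_; _,_; proj₁; proj₂)
open import Data.Sum.Base using (_⊎_; inj₁; inj₂)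
open import Level using (0ℓ)
open import Relation.Binary.Bundles using (Poset)
open import Relation.Binary.PropositionalEquality
  using (_≡_; _≢_; refl; sym; trans; cong; cong₂; subst; subst₂; ≢-sym)
open import Relation.Binary.Structures using (IsDecTotalOrder)
import Relation.Binary.Construct.NonStrictToStrict as ToStrict
import Relation.Binary.Reasoning.PartialOrder as PosetReasoning
open import Relation.Nullary using (yes; no; ¬_)

-- The real numbers, characterised up to isomorphism as the Dedekind-complete
-- totally ordered field.  Decidability of the order is automatic classically;
-- it is what lets an algorithm branch on comparisons of real numbers.

record CompleteOrderedField : Set₁ where
  infixl 7 _*_ _/_
  infixl 6 _+_ _-_
  infix  8 -_
  infix  9 _⁻¹
  infix  4 _≤_

  field
    Carrier : Set
    _≤_     : Carrier → Carrier → Set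
    _+_ _*_ : Carrier → Carrier → Carrier
    -_ _⁻¹  : Carrier → Carrier
    0# 1#   : Carrier

    isCommutativeRing : IsCommutativeRing _≡_ _+_ _*_ -_ 0# 1#
    0≢1               : 0# ≢ 1#
    -- 0# ⁻¹ is unconstrained
    ⁻¹-inverseʳ       : ∀ {x} → x ≢ 0# → x * x ⁻¹ ≡ 1#

    isDecTotalOrder   : IsDecTotalOrder _≡_ _≤_
    +-monoʳ-≤         : ∀ x {y z} → y ≤ z → x + y ≤ x + z
    *-nonNegative     : ∀ {x y} → 0# ≤ x → 0# ≤ y → 0# ≤ x * y

  UpperBound : (Carrier → Set) → Carrier → Set
  UpperBound P b = ∀ {x} → P x → x ≤ b

  Supremum : (Carrier → Set) → Carrier → Set
  Supremum P s = UpperBound P s × (∀ {b} → UpperBound P b → s ≤ b)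

  field
    complete : (P : Carrier → Set) → ∃ P → ∃ (UpperBound P) → ∃ (Supremum P)

  commutativeRing : CommutativeRing 0ℓ 0ℓ
  commutativeRing = record { isCommutativeRing = isCommutativeRing }

  open CommutativeRing commutativeRing public
    using (ring; semiring; commutativeSemiring; +-comm; +-assoc; +-identityˡ;
           +-identityʳ; *-comm; *-assoc; *-identityˡ; *-identityʳ; zeroˡ; zeroʳ;
           -‿inverseˡ; -‿inverseʳ; distribˡ; distribʳ)
  open IsDecTotalOrder isDecTotalOrder public
    using (_≤?_; _≟_; isPartialOrder)
    renaming (refl to ≤-refl; reflexive to ≤-reflexive; trans to ≤-trans;
              antisym to ≤-antisym; total to ≤-total)
  open ToStrict _≡_ _≤_ public using (_<_)
  open Exp semiring public using (_^_)
  open Mult semiring public using () renaming (_×_ to _·_)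
  open Sum semiring public using (sum)

  _-_ _/_ : Carrier → Carrier → Carrier
  x - y = x + - y
  x / y = x * y ⁻¹

  poset : Poset 0ℓ 0ℓ 0ℓ
  poset = record { isPartialOrder = isPartialOrder }

module Roots (ℝ : CompleteOrderedField) where
  open CompleteOrderedField ℝ
  open PosetReasoning poset
  open Solver commutativeSemiring using (solve; _:+_; _:*_; _:=_; con)

  ≰⇒≥ : ∀ {x y} → ¬ (x ≤ y) → y ≤ x
  ≰⇒≥ {x} {y} x≰y with ≤-total x y
  ... | inj₁ x≤y = ⊥-elim (x≰y x≤y)
  ... | inj₂ y≤x = y≤x

  +-mono-≤ : ∀ {a b c d} → a ≤ b → c ≤ d → a + c ≤ b + d
  +-mono-≤ {a} {b} {c} {d} a≤b c≤d = begin
    a + c ≤⟨ +-monoʳ-≤ a c≤d ⟩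
    a + d ≡⟨ +-comm a d ⟩
    d + a ≤⟨ +-monoʳ-≤ d a≤b ⟩
    d + b ≡⟨ +-comm d b ⟩
    b + d ∎

  +-cancelˡ-≤ : ∀ x {y z} → x + y ≤ x + z → y ≤ z
  +-cancelˡ-≤ x {y} {z} p = subst₂ _≤_ (cancel y) (cancel z) (+-monoʳ-≤ (- x) p)
    where
    cancel : ∀ y → - x + (x + y) ≡ y
    cancel y = trans (sym (+-assoc (- x) x y))
                     (trans (cong (_+ y) (-‿inverseˡ x)) (+-identityˡ y))

  x+[y-x]≡y : ∀ x y → x + (y - x) ≡ y
  x+[y-x]≡y x y = trans (solve 3 (λ x y n → x :+ (y :+ n) := (x :+ n) :+ y) refl x y (- x))
                        (trans (cong (_+ y) (-‿inverseʳ x)) (+-identityˡ y))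

  y-x≥0 : ∀ {x y} → x ≤ y → 0# ≤ y - x
  y-x≥0 {x} {y} x≤y = +-cancelˡ-≤ x
    (subst₂ _≤_ (sym (+-identityʳ x)) (sym (x+[y-x]≡y x y)) x≤y)

  x≤x+y : ∀ x {y} → 0# ≤ y → x ≤ x + y
  x≤x+y x {y} 0≤y = begin
    x      ≡⟨ +-identityʳ x ⟨
    x + 0# ≤⟨ +-monoʳ-≤ x 0≤y ⟩
    x + y  ∎

  *-monoʳ-≤ : ∀ {x y z} → 0# ≤ x → y ≤ z → x * y ≤ x * z
  *-monoʳ-≤ {x} {y} {z} 0≤x y≤z = begin
    x * y               ≤⟨ x≤x+y _ (*-nonNegative 0≤x (y-x≥0 y≤z)) ⟩
    x * y + x * (z - y) ≡⟨ distribˡ x y (z - y) ⟨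
    x * (y + (z - y))   ≡⟨ cong (x *_) (x+[y-x]≡y y z) ⟩
    x * z               ∎

  *-mono-≤ : ∀ {a b c d} → 0# ≤ b → 0# ≤ c → a ≤ b → c ≤ d → a * c ≤ b * d
  *-mono-≤ {a} {b} {c} {d} 0≤b 0≤c a≤b c≤d = begin
    a * c ≡⟨ *-comm a c ⟩
    c * a ≤⟨ *-monoʳ-≤ 0≤c a≤b ⟩
    c * b ≡⟨ *-comm c b ⟩
    b * c ≤⟨ *-monoʳ-≤ 0≤b c≤d ⟩
    b * d ∎

  x²≥0 : ∀ x → 0# ≤ x * x
  x²≥0 x with ≤-total 0# x
  ... | inj₁ 0≤x = *-nonNegative 0≤x 0≤x
  ... | inj₂ x≤0 = subst (0# ≤_) [-x]²≡x² (*-nonNegative 0≤-x 0≤-x)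
    where
    0≤-x : 0# ≤ - x
    0≤-x = subst (0# ≤_) (+-identityˡ (- x)) (y-x≥0 x≤0)
    open RingProperties ring using (-‿distribˡ-*; -‿distribʳ-*; -‿involutive)
    [-x]²≡x² : - x * - x ≡ x * x
    [-x]²≡x² = trans (sym (-‿distribˡ-* x (- x)))
      (trans (cong -_ (sym (-‿distribʳ-* x x))) (-‿involutive (x * x)))

  0≤1 : 0# ≤ 1#
  0≤1 = subst (0# ≤_) (*-identityˡ 1#) (x²≥0 1#)

  ⁻¹-nonNegative : ∀ {x} → 0# < x → 0# ≤ x ⁻¹
  ⁻¹-nonNegative {x} (0≤x , 0≢x) = begin
    0#              ≤⟨ *-nonNegative 0≤x (x²≥0 (x ⁻¹)) ⟩
    x * (x ⁻¹ * x ⁻¹) ≡⟨ *-assoc x _ _ ⟨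
    x * x ⁻¹ * x ⁻¹ ≡⟨ cong (_* x ⁻¹) (⁻¹-inverseʳ (≢-sym 0≢x)) ⟩
    1# * x ⁻¹       ≡⟨ *-identityˡ _ ⟩
    x ⁻¹            ∎

  x*[y/x]≡y : ∀ {x} → 0# < x → ∀ y → x * (y / x) ≡ y
  x*[y/x]≡y {x} (_ , 0≢x) y =
    trans (solve 3 (λ x y i → x :* (y :* i) := (x :* i) :* y) refl x y (x ⁻¹))
      (trans (cong (_* y) (⁻¹-inverseʳ (≢-sym 0≢x))) (*-identityˡ y))

  ^-nonNegative : ∀ {x} → 0# ≤ x → ∀ n → 0# ≤ x ^ n
  ^-nonNegative 0≤x zero    = 0≤1
  ^-nonNegative 0≤x (suc n) = *-nonNegative 0≤x (^-nonNegative 0≤x n)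

  ^-mono-≤ : ∀ {x y} → 0# ≤ x → x ≤ y → ∀ n → x ^ n ≤ y ^ n
  ^-mono-≤ 0≤x x≤y zero    = ≤-refl
  ^-mono-≤ 0≤x x≤y (suc n) =
    *-mono-≤ (≤-trans 0≤x x≤y) (^-nonNegative 0≤x n) x≤y (^-mono-≤ 0≤x x≤y n)

  Below : ℕ → Carrier → Carrier → Set
  Below n x y = y ≤ 0# ⊎ y ^ n ≤ x

  below⇒≤1⊎≤x : ∀ n .{{_ : NonZero n}} {x y} → Below n x y → y ≤ 1# ⊎ y ≤ x
  below⇒≤1⊎≤x _       (inj₁ y≤0) = inj₁ (≤-trans y≤0 0≤1)
  below⇒≤1⊎≤x (suc n) {x} {y} (inj₂ yⁿ≤x) with ≤-total y 1#
  ... | inj₁ y≤1 = inj₁ y≤1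
  ... | inj₂ 1≤y = inj₂ (begin
    y         ≡⟨ *-identityʳ y ⟨
    y * 1#    ≤⟨ *-monoʳ-≤ (≤-trans 0≤1 1≤y) (1≤yⁿ n) ⟩
    y * y ^ n ≤⟨ yⁿ≤x ⟩
    x         ∎)
    where
    1≤yⁿ : ∀ k → 1# ≤ y ^ k
    1≤yⁿ zero    = ≤-refl
    1≤yⁿ (suc k) = begin
      1#        ≡⟨ *-identityˡ 1# ⟨
      1# * 1#   ≤⟨ *-mono-≤ (≤-trans 0≤1 1≤y) 0≤1 1≤y (1≤yⁿ k) ⟩
      y * y ^ k ∎

  below-bounded : ∀ n .{{_ : NonZero n}} x → ∃ (UpperBound (Below n x))
  below-bounded n x with ≤-total 1# x
  ... | inj₁ 1≤x = x , λ {y} b → bound y (below⇒≤1⊎≤x n b)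
    where
    bound : ∀ y → y ≤ 1# ⊎ y ≤ x → y ≤ x
    bound _ (inj₁ y≤1) = ≤-trans y≤1 1≤x
    bound _ (inj₂ y≤x) = y≤x
  ... | inj₂ x≤1 = 1# , λ {y} b → bound y (below⇒≤1⊎≤x n b)
    where
    bound : ∀ y → y ≤ 1# ⊎ y ≤ x → y ≤ 1#
    bound _ (inj₁ y≤1) = y≤1
    bound _ (inj₂ y≤x) = ≤-trans y≤x x≤1

  root-supremum : ∀ n .{{_ : NonZero n}} x → ∃ (Supremum (Below n x))
  root-supremum n x = complete (Below n x) (0# , inj₁ ≤-refl) (below-bounded n x)

  -- The nonnegative n-th root of x for 0# ≤ x, see root-nonNegative and root-^.
  root : ∀ n .{{_ : NonZero n}} → Carrier → Carrier
  root n x = proj₁ (root-supremum n x)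

  root-nonNegative : ∀ n .{{_ : NonZero n}} x → 0# ≤ root n x
  root-nonNegative n x = proj₁ (proj₂ (root-supremum n x)) (inj₁ ≤-refl)

  -- The secant slopes of the n-th power on [ s , s + 1# ] are at most C n s;
  -- those on [ 0# , s ] are at most D n s.

  C D : ℕ → Carrier → Carrier
  C zero    s = 0#
  C (suc n) s = s * C n s + s ^ n + C n s
  D zero    s = 0#
  D (suc n) s = s * D n s + s ^ n

  D-nonNegative : ∀ {s} → 0# ≤ s → ∀ n → 0# ≤ D n s
  D-nonNegative 0≤s zero    = ≤-refl
  D-nonNegative 0≤s (suc n) = ≤-trans (*-nonNegative 0≤s (D-nonNegative 0≤s n))
                                      (x≤x+y _ (^-nonNegative 0≤s n))

  C-nonNegative : ∀ {s} → 0# ≤ s → ∀ n → 0# ≤ C n s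
  C-nonNegative 0≤s zero    = ≤-refl
  C-nonNegative 0≤s (suc n) =
    ≤-trans (*-nonNegative 0≤s (C-nonNegative 0≤s n))
      (≤-trans (x≤x+y _ (^-nonNegative 0≤s n)) (x≤x+y _ (C-nonNegative 0≤s n)))

  ^-upper : ∀ {s δ} → 0# ≤ s → 0# ≤ δ → δ ≤ 1# → ∀ n → (s + δ) ^ n ≤ s ^ n + δ * C n s
  ^-upper {s} {δ} 0≤s 0≤δ δ≤1 zero = x≤x+y 1# (*-nonNegative 0≤δ ≤-refl)
  ^-upper {s} {δ} 0≤s 0≤δ δ≤1 (suc n) = begin
    (s + δ) * (s + δ) ^ n
      ≤⟨ *-monoʳ-≤ (≤-trans 0≤s (x≤x+y s 0≤δ)) (^-upper 0≤s 0≤δ δ≤1 n) ⟩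
    (s + δ) * (s ^ n + δ * C n s)
      ≡⟨ solve 4 (λ s δ p c → (s :+ δ) :* (p :+ δ :* c)
                           := (s :* p :+ δ :* (s :* c :+ p)) :+ δ :* (δ :* c))
               refl s δ (s ^ n) (C n s) ⟩
    s * s ^ n + δ * (s * C n s + s ^ n) + δ * (δ * C n s)
      ≤⟨ +-monoʳ-≤ _ (*-monoʳ-≤ 0≤δ
           (*-mono-≤ 0≤1 (C-nonNegative 0≤s n) δ≤1 ≤-refl)) ⟩
    s * s ^ n + δ * (s * C n s + s ^ n) + δ * (1# * C n s)
      ≡⟨ solve 4 (λ s δ p c → (s :* p :+ δ :* (s :* c :+ p)) :+ δ :* (con 1 :* c)
                           := s :* p :+ δ :* (s :* c :+ p :+ c))
               refl s δ (s ^ n) (C n s) ⟩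
    s * s ^ n + δ * (s * C n s + s ^ n + C n s) ∎

  ^-lower : ∀ {u δ} → 0# ≤ u → 0# ≤ δ → ∀ n → (u + δ) ^ n ≤ u ^ n + δ * D n (u + δ)
  ^-lower {u} {δ} 0≤u 0≤δ zero    = x≤x+y 1# (*-nonNegative 0≤δ ≤-refl)
  ^-lower {u} {δ} 0≤u 0≤δ (suc n) = begin
    (u + δ) * p
      ≡⟨ distribʳ p u δ ⟩
    u * p + δ * p
      ≤⟨ +-mono-≤ (*-monoʳ-≤ 0≤u (^-lower 0≤u 0≤δ n)) ≤-refl ⟩
    u * (u ^ n + δ * d) + δ * p
      ≤⟨ x≤x+y _ (*-nonNegative 0≤δ (*-nonNegative 0≤δ (D-nonNegative 0≤u+δ n))) ⟩
    u * (u ^ n + δ * d) + δ * p + δ * (δ * d)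
      ≡⟨ solve 5 (λ u δ q p d → (u :* (q :+ δ :* d) :+ δ :* p) :+ δ :* (δ :* d)
                             := u :* q :+ δ :* ((u :+ δ) :* d :+ p))
               refl u δ (u ^ n) p d ⟩
    u * u ^ n + δ * ((u + δ) * d + p) ∎
    where
    p = (u + δ) ^ n
    d = D n (u + δ)
    0≤u+δ = ≤-trans 0≤u (x≤x+y u 0≤δ)

  0<x+1 : ∀ {x} → 0# ≤ x → 0# < x + 1#
  0<x+1 {x} 0≤x = ≤-trans 0≤x (x≤x+y x 0≤1) , λ 0≡x+1 → 0≢1 (≤-antisym 0≤1 (begin
    1#     ≡⟨ +-identityˡ 1# ⟨
    0# + 1# ≤⟨ +-mono-≤ 0≤x ≤-refl ⟩
    x + 1# ≡⟨ 0≡x+1 ⟨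
    0#     ∎))

  -- A positive step below a given bound b, with step * k below a given gap.
  small-step : ∀ {b k g} → 0# < b → 0# ≤ k → 0# < g →
               ∃[ δ ] (0# < δ × δ ≤ b × δ * k + δ ≤ g)
  small-step {b} {k} {g} 0<b 0≤k 0<g with ≤-total b (g / (k + 1#))
  ... | inj₁ b≤q = b , 0<b , ≤-refl , (begin
    b * k + b              ≡⟨ solve 2 (λ b k → b :* k :+ b := (k :+ con 1) :* b) refl b k ⟩
    (k + 1#) * b           ≤⟨ *-monoʳ-≤ (proj₁ 0<k+1) b≤q ⟩
    (k + 1#) * (g / (k + 1#)) ≡⟨ x*[y/x]≡y 0<k+1 g ⟩
    g                      ∎)
    where 0<k+1 = 0<x+1 0≤k
  ... | inj₂ q≤b = q , (*-nonNegative (proj₁ 0<g) (⁻¹-nonNegative 0<k+1) , 0≢q) , q≤b ,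
    ≤-reflexive (trans (solve 2 (λ b k → b :* k :+ b := (k :+ con 1) :* b) refl q k)
                       (x*[y/x]≡y 0<k+1 g))
    where
    0<k+1 = 0<x+1 0≤k
    q = g / (k + 1#)
    0≢q : 0# ≢ q
    0≢q 0≡q = proj₂ 0<g (trans (sym (zeroʳ (k + 1#)))
      (trans (cong ((k + 1#) *_) 0≡q) (x*[y/x]≡y 0<k+1 g)))

  0<y-x : ∀ {x y} → x ≤ y → x ≢ y → 0# < y - x
  0<y-x {x} {y} x≤y x≢y = y-x≥0 x≤y , λ 0≡ → x≢y
    (trans (sym (+-identityʳ x)) (trans (cong (x +_) 0≡) (x+[y-x]≡y x y)))

  x+δ≰x : ∀ {x δ} → 0# < δ → ¬ (x + δ ≤ x)
  x+δ≰x {x} {δ} (0≤δ , 0≢δ) p =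
    0≢δ (≤-antisym 0≤δ (+-cancelˡ-≤ x (subst (x + δ ≤_) (sym (+-identityʳ x)) p)))

  root-^ : ∀ n .{{_ : NonZero n}} {x} → 0# ≤ x → root n x ^ n ≡ x
  root-^ n@(suc k) {x} 0≤x = ≤-antisym s^n≤x x≤s^n
    where
    s = root n x
    0≤s = root-nonNegative n x
    upper = proj₁ (proj₂ (root-supremum n x))
    least = proj₂ (proj₂ (root-supremum n x))

    x≤s^n : x ≤ s ^ n
    x≤s^n with x ≤? s ^ n
    ... | yes p = p
    ... | no x≰ with small-step (0≤1 , 0≢1) (C-nonNegative 0≤s n)
                       (0<y-x (≰⇒≥ x≰) (λ e → x≰ (≤-reflexive (sym e))))
    ...   | δ , 0<δ , δ≤1 , step = ⊥-elim (x+δ≰x 0<δ (upper (inj₂ (begin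
      (s + δ) ^ n           ≤⟨ ^-upper 0≤s (proj₁ 0<δ) δ≤1 n ⟩
      s ^ n + δ * C n s     ≤⟨ +-monoʳ-≤ _ (x≤x+y _ (proj₁ 0<δ)) ⟩
      s ^ n + (δ * C n s + δ) ≤⟨ +-monoʳ-≤ _ step ⟩
      s ^ n + (x - s ^ n)   ≡⟨ x+[y-x]≡y (s ^ n) x ⟩
      x                     ∎))))

    s^n≤x : s ^ n ≤ x
    s^n≤x with s ^ n ≤? x
    ... | yes p = p
    ... | no ≰x with small-step 0<s (D-nonNegative 0≤s n)
                       (0<y-x (≰⇒≥ ≰x) (λ e → ≰x (≤-reflexive (sym e))))
      where
      0<s : 0# < s
      0<s = 0≤s , λ 0≡s → ≰x (subst (_≤ x)
              (trans (sym (zeroˡ (s ^ k))) (cong (_* s ^ k) 0≡s)) 0≤x)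
    ...   | δ , 0<δ , δ≤s , step =
      ⊥-elim (x+δ≰x 0<δ (subst (_≤ u) (sym u+δ≡s) (least λ {y} → u-upper y)))
      where
      u = s - δ
      0≤u = y-x≥0 δ≤s
      u+δ≡s : u + δ ≡ s
      u+δ≡s = trans (+-comm u δ) (x+[y-x]≡y δ s)
      u^n≰x : ¬ (u ^ n ≤ x)
      u^n≰x u^n≤x = x+δ≰x 0<δ (begin
        s ^ n + δ                       ≡⟨ cong (λ z → z ^ n + δ) u+δ≡s ⟨
        (u + δ) ^ n + δ                 ≤⟨ +-mono-≤ (^-lower 0≤u (proj₁ 0<δ) n) ≤-refl ⟩
        u ^ n + δ * D n (u + δ) + δ     ≡⟨ cong (λ z → u ^ n + δ * D n z + δ) u+δ≡s ⟩
        u ^ n + δ * D n s + δ           ≡⟨ +-assoc _ _ _ ⟩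
        u ^ n + (δ * D n s + δ)         ≤⟨ +-mono-≤ u^n≤x step ⟩
        x + (s ^ n - x)                 ≡⟨ x+[y-x]≡y x (s ^ n) ⟩
        s ^ n                           ∎)
      u-upper : ∀ y → Below n x y → y ≤ u
      u-upper y (inj₁ y≤0) = ≤-trans y≤0 0≤u
      u-upper y (inj₂ y^n≤x) with y ≤? u
      ... | yes y≤u = y≤u
      ... | no  y≰u = ⊥-elim (u^n≰x (≤-trans (^-mono-≤ 0≤u (≰⇒≥ y≰u) n) y^n≤x))

module Scheduling (ℝ : CompleteOrderedField) where
  open CompleteOrderedField ℝ
  open Roots ℝ using (root; +-mono-≤)

  record Job : Set where
    field
      release processing deadline : Carrier

  open Job

  -- The job sequences that satisfy the slack condition with parameter ε.
  record Admissible (ε : Carrier) (J : List Job) : Set where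
    field
      release-nonNegative : ∀ i → 0# ≤ release (lookup J i)
      processing-positive : ∀ i → 0# < processing (lookup J i)
      slack   : ∀ i → (1# + ε) * processing (lookup J i)
                        ≤ deadline (lookup J i) - release (lookup J i)
      ordered : ∀ i j → release (lookup J i) < release (lookup J j) → i <ᶠ j

  -- Rejection, or acceptance with a machine and a starting time.
  Decision : ℕ → Set
  Decision m = Maybe (Fin m × Carrier)

  Schedule : ℕ → List Job → Set
  Schedule m J = Fin (length J) → Decision m

  module _ {m : ℕ} (J : List Job) (S : Schedule m J) where

    RunsAt : Fin (length J) → Fin m → Carrier → Set
    RunsAt i k t =
      ∃[ s ] (S i ≡ just (k , s) × s ≤ t × t < s + processing (lookup J i))

    record Feasible : Set where
      field
        starts-after-release  : ∀ {i k s} → S i ≡ just (k , s) →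
                                release (lookup J i) ≤ s
        completes-by-deadline : ∀ {i k s} → S i ≡ just (k , s) →
                                s + processing (lookup J i) ≤ deadline (lookup J i)
        one-job-at-a-time     : ∀ {i j k t} → RunsAt i k t → RunsAt j k t → i ≡ j

    load : Carrier
    load = sum λ i → maybe′ (λ _ → processing (lookup J i)) 0# (S i)

  OfflineValue : ℕ → List Job → Carrier → Set
  OfflineValue m J v = ∃[ S ] (Feasible {m} J S × load J S ≡ v)

  offlineValue-inhabited : ∀ m J → ∃ (OfflineValue m J)
  offlineValue-inhabited m J = load J reject , reject , feasible , refl
    where
    reject : Schedule m J
    reject _ = nothing
    feasible : Feasible J reject
    feasible = record
      { starts-after-release  = λ ()
      ; completes-by-deadline = λ ()
      ; one-job-at-a-time     = λ ()
      }

  sum-mono-≤ : ∀ {n} {f g : Fin n → Carrier} → (∀ i → f i ≤ g i) → sum f ≤ sum g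
  sum-mono-≤ {zero}  f≤g = ≤-refl
  sum-mono-≤ {suc n} f≤g = +-mono-≤ (f≤g zero) (sum-mono-≤ λ i → f≤g (suc i))

  offlineValue-bounded : ∀ m {ε J} → Admissible ε J → ∃ (UpperBound (OfflineValue m J))
  offlineValue-bounded m {J = J} adm = sum (λ i → processing (lookup J i)) , bound
    where
    bound : UpperBound (OfflineValue m J) (sum λ i → processing (lookup J i))
    bound (S , _ , refl) = sum-mono-≤ λ i → term i (S i)
      where
      term : ∀ i (d : Decision m) →
             maybe′ (λ _ → processing (lookup J i)) 0# d ≤ processing (lookup J i)
      term i (just _) = ≤-refl
      term i nothing  = proj₁ (Admissible.processing-positive adm i)

  -- OfflineValue m J holds of finitely many numbers only, one for each set of
  -- accepted jobs at most, so that its supremum is its maximum.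
  OPT-supremum : ∀ m {ε J} → Admissible ε J → ∃ (Supremum (OfflineValue m J))
  OPT-supremum m {J = J} adm =
    complete (OfflineValue m J) (offlineValue-inhabited m J) (offlineValue-bounded m adm)

  OPT : ∀ m {ε} J → Admissible ε J → Carrier
  OPT m J adm = proj₁ (OPT-supremum m adm)

  OPT-maximum : ∀ m {ε} J (adm : Admissible ε J) {v} →
                OfflineValue m J v → UpperBound (OfflineValue m J) v → OPT m J adm ≡ v
  OPT-maximum m J adm attained upper =
    ≤-antisym (proj₂ (proj₂ (OPT-supremum m adm)) upper)
              (proj₁ (proj₂ (OPT-supremum m adm)) attained)

  -- A deterministic online algorithm for m machines and slack ε decides on each
  -- job from the jobs before it in the sequence, given as the first argument of
  -- decide, and that job; its own earlier decisions are functions of the former.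
  record OnlineAlgorithm (m : ℕ) (ε : Carrier) : Set where
    field
      decide : List Job → Job → Decision m

    schedule : ∀ J → Schedule m J
    schedule J i = decide (take (toℕ i) J) (lookup J i)

    field
      feasible : ∀ {J} → Admissible ε J → Feasible J (schedule J)

    ALG : List Job → Carrier
    ALG J = load J (schedule J)

  StrictCompetitiveRatioAtMost : ∀ {m ε} → OnlineAlgorithm m ε → Carrier → Set
  StrictCompetitiveRatioAtMost {m} {ε} A c =
    ∀ J (adm : Admissible ε J) → OPT m J adm ≤ c * OnlineAlgorithm.ALG A J

-- Put f = ((1 + ε) / ε) ^ (1 / m).  At the release r of a job with deadline d,
-- let l₁ ≥ … ≥ lₘ be the outstanding loads of the machines.  The job is admitted
-- iff lᵢ f ^ i ≤ d - r for all i, and placed on the most loaded machine on which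
-- it fits; by the slack condition it fits on the least loaded one.
--
-- Compare with a virtual first-come first-served machine that receives a job of
-- length f p for every accepted job of length p, and let V be the time at which
-- it becomes idle.  Then r + lᵢ f ^ i ≤ V is invariant: a machine k that loses
-- its place in the order could not take the job, so p > d - r - lₖ ≥ lₖ (f ^ k - 1),
-- and the growth of V by f p pays for the additional factor f.  Hence the window
-- [ r , d ] of a rejected job lies within a busy period of the virtual machine,
-- whose total busy time is f ALG.  So each of the m machines of an optimal
-- schedule processes rejected jobs for at most f ALG.

module Submission where

open import Defs
open import Data.Nat.Base using (ℕ; NonZero)
open import Data.Product using (∃-syntax)

import Algebra.Construct.NaturalChoice.Max as Max
import Algebra.Construct.NaturalChoice.Min as Min
import Algebra.Properties.Semiring.Mult as Mult
import Algebra.Properties.Semiring.Sum as Sum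
import Algebra.Solver.Ring.NaturalCoefficients.Default as Solver
open import Data.Bool.Base using (if_then_else_)
open import Data.Empty using (⊥-elim)
open import Data.Fin.Base using (Fin; zero; suc; toℕ) renaming (_<_ to _<ᶠ_)
open import Data.Fin.Properties using (any?; all?; ¬∀⟶∃¬; <-cmp) renaming (_≟_ to _≟ᶠ_)
open import Data.List.Base using (List; []; _∷_; foldl; length; lookup; take)
open import Data.Maybe.Base using (Maybe; just; nothing; maybe′)
import Data.Nat.Base as ℕ
import Data.Nat.Properties as ℕ
open import Data.Product using (∃; _×_; _,_; proj₁; proj₂)
open import Data.Sum.Base using (_⊎_; inj₁; inj₂)
open import Data.Unit.Base using (tt)
open import Data.Vec.Functional using (Vector; updateAt; replicate)
open import Data.Vec.Functional.Properties using (updateAt-updates; updateAt-minimal)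
open import Function.Base using (_∘_; const; flip)
open import Level using (0ℓ)
open import Relation.Binary.Bundles using (TotalOrder)
open import Relation.Binary.Core using (Rel)
open import Relation.Binary.Definitions using (Total; Transitive; Tri; tri<; tri≈; tri>)
open import Relation.Binary.PropositionalEquality
  using (_≡_; _≢_; refl; sym; trans; cong; cong₂; subst; subst₂; ≢-sym)
import Relation.Binary.Reasoning.PartialOrder as PosetReasoning
open import Relation.Binary.Structures using (IsDecTotalOrder)
open import Relation.Nullary using (Dec; yes; no; does; ¬_; _×-dec_; _→-dec_)
open import Relation.Unary using (Pred; Decidable)

-- Counting over finite index sets

count : ∀ {n} {P : Pred (Fin n) 0ℓ} → Decidable P → ℕ
count {ℕ.zero}  P? = 0
count {ℕ.suc n} P? = (if does (P? zero) then 1 else 0) ℕ.+ count (P? ∘ suc)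

count-mono : ∀ {n} {P Q : Pred (Fin n) 0ℓ} (P? : Decidable P) (Q? : Decidable Q) →
             (∀ k → P k → Q k) → count P? ℕ.≤ count Q?
count-mono {ℕ.zero}  P? Q? P⊆Q = ℕ.z≤n
count-mono {ℕ.suc n} P? Q? P⊆Q with P? zero | Q? zero
... | yes p | yes q = ℕ.s≤s (count-mono (P? ∘ suc) (Q? ∘ suc) (P⊆Q ∘ suc))
... | yes p | no ¬q = ⊥-elim (¬q (P⊆Q zero p))
... | no ¬p | yes q = ℕ.m≤n⇒m≤1+n (count-mono (P? ∘ suc) (Q? ∘ suc) (P⊆Q ∘ suc))
... | no ¬p | no ¬q = count-mono (P? ∘ suc) (Q? ∘ suc) (P⊆Q ∘ suc)

-- Limits the growth of a rank when a single completion time changes: only the index `i` can be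
-- counted in excess.
count-mono-except : ∀ {n} {P Q : Pred (Fin n) 0ℓ} (P? : Decidable P) (Q? : Decidable Q) i →
                    (∀ k → k ≢ i → P k → Q k) → count P? ℕ.≤ ℕ.suc (count Q?)
count-mono-except P? Q? zero P⊆Q with P? zero | Q? zero
... | yes p | yes q = ℕ.m≤n⇒m≤1+n (ℕ.s≤s (count-mono (P? ∘ suc) (Q? ∘ suc) λ k → P⊆Q (suc k) λ ()))
... | yes p | no ¬q = ℕ.s≤s (count-mono (P? ∘ suc) (Q? ∘ suc) λ k → P⊆Q (suc k) λ ())
... | no ¬p | yes q =
  ℕ.m≤n⇒m≤1+n (ℕ.m≤n⇒m≤1+n (count-mono (P? ∘ suc) (Q? ∘ suc) λ k → P⊆Q (suc k) λ ()))
... | no ¬p | no ¬q = ℕ.m≤n⇒m≤1+n (count-mono (P? ∘ suc) (Q? ∘ suc) λ k → P⊆Q (suc k) λ ())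
count-mono-except P? Q? (suc i) P⊆Q
  with P? zero | Q? zero | count-mono-except (P? ∘ suc) (Q? ∘ suc) i
                             (λ k k≢i → P⊆Q (suc k) λ { refl → k≢i refl })
... | yes p | yes q | ih = ℕ.s≤s ih
... | yes p | no ¬q | ih = ⊥-elim (¬q (P⊆Q zero (λ ()) p))
... | no ¬p | yes q | ih = ℕ.m≤n⇒m≤1+n ih
... | no ¬p | no ¬q | ih = ih

count-all : ∀ {n} {P : Pred (Fin n) 0ℓ} (P? : Decidable P) → (∀ k → P k) → count P? ≡ n
count-all {ℕ.zero}  P? all = refl
count-all {ℕ.suc n} P? all with P? zero
... | yes p = cong ℕ.suc (count-all (P? ∘ suc) (all ∘ suc))
... | no ¬p = ⊥-elim (¬p (all zero))

count-none : ∀ {n} {P : Pred (Fin n) 0ℓ} (P? : Decidable P) → (∀ k → ¬ P k) → count P? ≡ 0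
count-none {ℕ.zero}  P? none = refl
count-none {ℕ.suc n} P? none with P? zero
... | yes p = ⊥-elim (none zero p)
... | no ¬p = count-none (P? ∘ suc) (none ∘ suc)

count-some : ∀ {n} {P : Pred (Fin n) 0ℓ} (P? : Decidable P) {i} → P i → 1 ℕ.≤ count P?
count-some P? {zero} p with P? zero
... | yes _ = ℕ.s≤s ℕ.z≤n
... | no ¬p = ⊥-elim (¬p p)
count-some P? {suc i} p = ℕ.≤-trans (count-some (P? ∘ suc) p) (ℕ.m≤n+m _ _)

-- Minima over finite index sets

total⇒reflexive : ∀ {A : Set} {_≲_ : Rel A 0ℓ} → Total _≲_ → ∀ x → x ≲ x
total⇒reflexive total x with total x x
... | inj₁ x≲x = x≲x
... | inj₂ x≲x = x≲x

-- `_≲_` is a total preorder on indices, so machines can be compared by completion time, in either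
-- direction.
minimum : ∀ {n} {_≲_ : Rel (Fin n) 0ℓ} {P : Pred (Fin n) 0ℓ} →
          Total _≲_ → Transitive _≲_ → Decidable P →
          (∀ k → ¬ P k) ⊎ ∃[ i ] (P i × (∀ k → P k → i ≲ k))
minimum {ℕ.zero}  total trans P? = inj₁ λ ()
minimum {ℕ.suc n} {_≲_} {P} total trans P?
  with P? zero | minimum (λ i j → total (suc i) (suc j)) trans (P? ∘ suc)
... | no ¬p | inj₁ none = inj₁ λ { zero → ¬p ; (suc k) → none k }
... | no ¬p | inj₂ (i , pᵢ , least) =
  inj₂ (suc i , pᵢ , λ { zero p → ⊥-elim (¬p p) ; (suc k) → least k })
... | yes p | inj₁ none =
  inj₂ (zero , p , λ { zero _ → total⇒reflexive total zero ; (suc k) pₖ → ⊥-elim (none k pₖ) })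
... | yes p | inj₂ (i , pᵢ , least) with total zero (suc i)
...   | inj₁ 0≲i =
  inj₂ (zero , p , λ { zero _ → total⇒reflexive total zero ; (suc k) pₖ → trans 0≲i (least k pₖ) })
...   | inj₂ i≲0 = inj₂ (suc i , pᵢ , λ { zero _ → i≲0 ; (suc k) → least k })

-- Ordered field arithmetic, finite sums and the growth factor

module OrderedField (ℝ : CompleteOrderedField) where
  open CompleteOrderedField ℝ public
  open Roots ℝ public
  open IsDecTotalOrder isDecTotalOrder using (isTotalOrder)
  open PosetReasoning poset public
  open Solver commutativeSemiring public using (solve; _:+_; _:*_; _:=_; con)

  private
    totalOrder : TotalOrder 0ℓ 0ℓ 0ℓ
    totalOrder = record { isTotalOrder = isTotalOrder }

  open Max totalOrder public
    using (_⊔_; x≤y⇒x⊔y≈y; x≤y⇒y⊔x≈y; x≤x⊔y; x≤y⊔x; ⊔-monoʳ-≤; ⊔-monoˡ-≤)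
  open Min totalOrder public
    using (_⊓_; x≤y⇒x⊓y≈x; x≤y⇒y⊓x≈x; x⊓y≤y; ⊓-glb; ⊓-monoˡ-≤)

  -- Linear arithmetic without subtraction, so that the side conditions are
  -- within reach of the commutative semiring solver.
  cancel : ∀ {a b x y} z → x + z ≡ a → b ≡ y + z → a ≤ b → x ≤ y
  cancel {a} {b} {x} {y} z x+z≡a b≡y+z a≤b = +-cancelˡ-≤ z
    (subst₂ _≤_ (trans (sym x+z≡a) (+-comm x z)) (trans b≡y+z (+-comm y z)) a≤b)

  +-monoˡ-≤ : ∀ z {x y} → x ≤ y → x + z ≤ y + z
  +-monoˡ-≤ z x≤y = +-mono-≤ x≤y ≤-refl

  *-monoˡ-≤ : ∀ {x y z} → 0# ≤ z → x ≤ y → x * z ≤ y * z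
  *-monoˡ-≤ {x} {y} {z} 0≤z x≤y = subst₂ _≤_ (*-comm z x) (*-comm z y) (*-monoʳ-≤ 0≤z x≤y)

  *-cancelˡ-≤ : ∀ {x y z} → 0# < x → x * y ≤ x * z → y ≤ z
  *-cancelˡ-≤ {x} {y} {z} 0<x xy≤xz =
    subst₂ _≤_ (undo y) (undo z) (*-monoʳ-≤ (⁻¹-nonNegative 0<x) xy≤xz)
    where
    undo : ∀ w → x ⁻¹ * (x * w) ≡ w
    undo w = trans (solve 3 (λ x w i → i :* (x :* w) := x :* (w :* i)) refl x w (x ⁻¹))
                   (x*[y/x]≡y 0<x w)

  -- The two sides differ by `(b - a) * (d - c)`.
  rearrangement : ∀ {a b c d} → a ≤ b → c ≤ d → a * d + b * c ≤ a * c + b * d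
  rearrangement {a} {b} {c} {d} a≤b c≤d =
    subst₂ (λ b d → a * d + b * c ≤ a * c + b * d) (x+[y-x]≡y a b) (x+[y-x]≡y c d) (begin
      a * (c + v) + (a + u) * c         ≤⟨ x≤x+y _ (*-nonNegative (y-x≥0 a≤b) (y-x≥0 c≤d)) ⟩
      a * (c + v) + (a + u) * c + u * v
        ≡⟨ solve 4 (λ a c u v → (a :* (c :+ v) :+ (a :+ u) :* c) :+ u :* v
                             := a :* c :+ (a :+ u) :* (c :+ v)) refl a c u v ⟩
      a * c + (a + u) * (c + v)         ∎)
    where
    u = b - a
    v = d - c

  x^n≤1 : ∀ {x} → 0# ≤ x → x ≤ 1# → ∀ n → x ^ n ≤ 1#
  x^n≤1 0≤x x≤1 ℕ.zero    = ≤-refl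
  x^n≤1 {x} 0≤x x≤1 (ℕ.suc n) = begin
    x * x ^ n ≤⟨ *-mono-≤ 0≤1 (^-nonNegative 0≤x n) x≤1 (x^n≤1 0≤x x≤1 n) ⟩
    1# * 1#   ≡⟨ *-identityˡ 1# ⟩
    1#        ∎

  ^-monoʳ-≤ : ∀ {x} → 1# ≤ x → ∀ {n k} → n ℕ.≤ k → x ^ n ≤ x ^ k
  ^-monoʳ-≤ {x} 1≤x {k = k} (ℕ.z≤n) = go k
    where
    go : ∀ k → 1# ≤ x ^ k
    go ℕ.zero    = ≤-refl
    go (ℕ.suc k) = begin
      1#        ≡⟨ *-identityˡ 1# ⟨
      1# * 1#   ≤⟨ *-mono-≤ (≤-trans 0≤1 1≤x) 0≤1 1≤x (go k) ⟩
      x * x ^ k ∎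
  ^-monoʳ-≤ 1≤x (ℕ.s≤s n≤k) = *-monoʳ-≤ (≤-trans 0≤1 1≤x) (^-monoʳ-≤ 1≤x n≤k)

  open Sum semiring public using (sum-replicate; ∑-distrib-+; ∑-comm)
  open Mult semiring public using (×-assoc-*)
  open Scheduling ℝ public

  sum-nonNegative : ∀ {n} {f : Fin n → Carrier} → (∀ i → 0# ≤ f i) → 0# ≤ sum f
  sum-nonNegative {ℕ.zero}  0≤f = ≤-refl
  sum-nonNegative {ℕ.suc n} 0≤f = ≤-trans (0≤f zero) (x≤x+y _ (sum-nonNegative (0≤f ∘ suc)))

  term≤sum : ∀ {n} {f : Fin n → Carrier} → (∀ i → 0# ≤ f i) → ∀ i → f i ≤ sum f
  term≤sum 0≤f zero    = x≤x+y _ (sum-nonNegative (0≤f ∘ suc))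
  term≤sum {f = f} 0≤f (suc i) = ≤-trans (term≤sum (0≤f ∘ suc) i)
    (subst (sum (f ∘ suc) ≤_) (+-comm _ _) (x≤x+y _ (0≤f zero)))

  -- Characterises the `m`-th root of `(1# + ε) / ε` without division or roots.
  record GrowthFactor (m : ℕ) (ε : Carrier) : Set where
    field
      f         : Carrier
      1≤f       : 1# ≤ f
      ε*f^m≡1+ε : ε * f ^ m ≡ 1# + ε
      0<ε       : 0# < ε

    0≤f : 0# ≤ f
    0≤f = ≤-trans 0≤1 1≤f

    0<1+ε : 0# < 1# + ε
    0<1+ε = subst (0# <_) (+-comm ε 1#) (0<x+1 (proj₁ 0<ε))

  root-growthFactor : ∀ m .{{_ : NonZero m}} {ε} → 0# < ε → GrowthFactor m ε
  root-growthFactor m {ε} 0<ε = record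
    { f = f ; 1≤f = 1≤f ; ε*f^m≡1+ε = ε*f^m≡1+ε ; 0<ε = 0<ε }
    where
    f : Carrier
    f = root m ((1# + ε) / ε)

    ε*f^m≡1+ε : ε * f ^ m ≡ 1# + ε
    ε*f^m≡1+ε = trans
      (cong (ε *_) (root-^ m (*-nonNegative (≤-trans 0≤1 (x≤x+y 1# (proj₁ 0<ε)))
                                            (⁻¹-nonNegative 0<ε))))
      (x*[y/x]≡y 0<ε (1# + ε))

    1≤f : 1# ≤ f
    1≤f with 1# ≤? f
    ... | yes 1≤f = 1≤f
    -- `f ≤ 1#` would give `f ^ m ≤ 1#`, hence `1# + ε ≤ ε`.
    ... | no  1≰f = ⊥-elim (x+δ≰x {ε} (0≤1 , 0≢1) (begin
      ε + 1#    ≡⟨ +-comm ε 1# ⟩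
      1# + ε    ≡⟨ ε*f^m≡1+ε ⟨
      ε * f ^ m ≤⟨ *-monoʳ-≤ (proj₁ 0<ε) (x^n≤1 (root-nonNegative m _) (≰⇒≥ 1≰f) m) ⟩
      ε * 1#    ≡⟨ *-identityʳ ε ⟩
      ε         ∎))

-- Measures on the line and packing of disjoint intervals

module Packing (ℝ : CompleteOrderedField) where
  open OrderedField ℝ

  Monotone : (Carrier → Carrier) → Set
  Monotone μ = ∀ {x y} → x ≤ y → μ x ≤ μ y

  -- A monotone function is read as the distribution function of a measure; on
  -- every subinterval of [ lo , hi ] that measure is at least the length.
  Covers : Carrier → Carrier → (Carrier → Carrier) → Set
  Covers lo hi μ = ∀ {x y} → lo ≤ x → x ≤ y → y ≤ hi → y + μ x ≤ x + μ y

  covers-shrink : ∀ {a b a′ b′ μ} → a ≤ a′ → b′ ≤ b → Covers a b μ → Covers a′ b′ μ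
  covers-shrink a≤a′ b′≤b cov a′≤x x≤y y≤b′ =
    cov (≤-trans a≤a′ a′≤x) x≤y (≤-trans y≤b′ b′≤b)

  covers-point : ∀ {a b μ} → b ≤ a → Covers a b μ
  covers-point {μ = μ} b≤a {x} {y} a≤x x≤y y≤b
    with ≤-antisym x≤y (≤-trans y≤b (≤-trans b≤a a≤x))
  ... | refl = ≤-refl

  covers-+ : ∀ {a b μ ν} → Covers a b μ → Monotone ν → Covers a b (λ x → μ x + ν x)
  covers-+ {μ = μ} {ν} cov mono {x} {y} a≤x x≤y y≤b = begin
    y + (μ x + ν x) ≡⟨ +-assoc _ _ _ ⟨
    y + μ x + ν x   ≤⟨ +-mono-≤ (cov a≤x x≤y y≤b) (mono x≤y) ⟩
    x + μ y + ν y   ≡⟨ +-assoc _ _ _ ⟩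
    x + (μ y + ν y) ∎

  covers-cong : ∀ {a b μ ν} → (∀ x → μ x ≡ ν x) → Covers a b μ → Covers a b ν
  covers-cong μ≗ν cov {x} {y} a≤x x≤y y≤b =
    subst₂ _≤_ (cong (y +_) (μ≗ν x)) (cong (x +_) (μ≗ν y)) (cov a≤x x≤y y≤b)

  covers-glue : ∀ {a b c μ} → Covers a b μ → Covers b c μ → Covers a c μ
  covers-glue {b = b} {μ = μ} left right {x} {y} a≤x x≤y y≤c
    with ≤-total y b | ≤-total b x
  ... | inj₁ y≤b | _        = left a≤x x≤y y≤b
  ... | inj₂ _   | inj₁ b≤x = right b≤x x≤y y≤c
  ... | inj₂ b≤y | inj₂ x≤b = cancel (b + μ b)
    (solve 4 (λ y mx b mb → (y :+ mx) :+ (b :+ mb) := (b :+ mx) :+ (y :+ mb)) refl y (μ x) b (μ b))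
    (solve 4 (λ x my b mb → (x :+ mb) :+ (b :+ my) := (x :+ my) :+ (b :+ mb)) refl x (μ y) b (μ b))
    (+-mono-≤ (left a≤x x≤b ≤-refl) (right ≤-refl b≤y y≤c))

  -- For `lo ≤ hi`, the distribution function, up to a constant, of length restricted to
  -- `[ lo , hi ]`.
  clip : Carrier → Carrier → Carrier → Carrier
  clip lo hi x = (lo ⊔ x) ⊓ hi

  clip-mono : ∀ lo hi → Monotone (clip lo hi)
  clip-mono lo hi x≤y = ⊓-monoˡ-≤ hi (⊔-monoʳ-≤ lo x≤y)

  clip-bounded : ∀ {lo hi} → lo ≤ hi → ∀ {w} → hi ≤ lo + w →
                 ∀ a b → clip lo hi b ≤ clip lo hi a + w
  clip-bounded {lo} {hi} lo≤hi {w} hi≤lo+w a b = begin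
    clip lo hi b     ≤⟨ x⊓y≤y _ hi ⟩
    hi               ≤⟨ hi≤lo+w ⟩
    lo + w           ≤⟨ +-monoˡ-≤ w (⊓-glb (x≤x⊔y lo a) lo≤hi) ⟩
    clip lo hi a + w ∎

  clip-covers : ∀ {lo hi} → Covers lo hi (clip lo hi)
  clip-covers {lo} {hi} {x} {y} lo≤x x≤y y≤hi = ≤-reflexive
    (trans (cong (y +_) (inside lo≤x (≤-trans x≤y y≤hi)))
           (trans (+-comm y x) (cong (x +_) (sym (inside (≤-trans lo≤x x≤y) y≤hi)))))
    where
    inside : ∀ {z} → lo ≤ z → z ≤ hi → clip lo hi z ≡ z
    inside lo≤z z≤hi = trans (cong (_⊓ hi) (x≤y⇒x⊔y≈y lo≤z)) (x≤y⇒x⊓y≈x z≤hi)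

  -- For `s ≤ e`, the distribution function, up to a constant, of the measure `μ` without its mass
  -- between `s` and `e`: constant there, with the increments of `μ` elsewhere.
  collapse : Carrier → Carrier → (Carrier → Carrier) → Carrier → Carrier
  collapse s e μ x = μ (x ⊓ s) + μ (x ⊔ e)

  collapse-mono : ∀ s e {μ} → Monotone μ → Monotone (collapse s e μ)
  collapse-mono s e mono x≤y = +-mono-≤ (mono (⊓-monoˡ-≤ s x≤y)) (mono (⊔-monoˡ-≤ e x≤y))

  collapse-before : ∀ {s e} → s ≤ e → ∀ μ {x} → x ≤ s → collapse s e μ x ≡ μ x + μ e
  collapse-before s≤e μ x≤s =
    cong₂ (λ u v → μ u + μ v) (x≤y⇒x⊓y≈x x≤s) (x≤y⇒x⊔y≈y (≤-trans x≤s s≤e))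

  collapse-after : ∀ {s e} → s ≤ e → ∀ μ {x} → e ≤ x → collapse s e μ x ≡ μ s + μ x
  collapse-after s≤e μ e≤x =
    cong₂ (λ u v → μ u + μ v) (x≤y⇒y⊓x≈x (≤-trans s≤e e≤x)) (x≤y⇒y⊔x≈y e≤x)

  -- Each packed interval is removed from the line by collapsing it, which
  -- leaves the measure of the intervals disjoint from it unchanged.
  packing : ∀ {n} (p : Fin n → Carrier) (start : Fin n → Maybe Carrier) {μ q T} →
            (∀ i → 0# ≤ p i) →
            (∀ {i j s t} → i ≢ j → start i ≡ just s → start j ≡ just t →
               s + p i ≤ t ⊎ t + p j ≤ s) →
            Monotone μ →
            (∀ {i s} → start i ≡ just s → p i + μ s ≤ μ (s + p i)) →
            (∀ a b → μ b + q ≤ μ a + T) →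
            q + sum (λ i → maybe′ (λ _ → p i) 0# (start i)) ≤ T
  packing {ℕ.zero} p start {μ} {q} {T} _ _ _ _ total = cancel (μ 0#)
    (solve 2 (λ q m → (q :+ con 0) :+ m := m :+ q) refl q (μ 0#))
    (+-comm (μ 0#) T) (total 0# 0#)
  packing {ℕ.suc n} p start {μ} {q} {T} 0≤p disjoint mono inside total
    with start zero in eq
  ... | nothing = subst (_≤ T) (cong (q +_) (sym (+-identityˡ _)))
    (packing (p ∘ suc) (start ∘ suc) {μ} (0≤p ∘ suc)
      (λ i≢j → disjoint λ { refl → i≢j refl }) mono inside total)
  ... | just s = subst (_≤ T) (+-assoc _ _ _)
    (packing (p ∘ suc) (start ∘ suc) {collapse s e μ} (0≤p ∘ suc)
      (λ i≢j → disjoint λ { refl → i≢j refl }) (collapse-mono s e mono) inside′ total′)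
    where
    e = s + p zero
    s≤e = x≤x+y s (0≤p zero)
    inside′ : ∀ {i t} → start (suc i) ≡ just t →
              p (suc i) + collapse s e μ t ≤ collapse s e μ (t + p (suc i))
    inside′ {i} {t} eqᵢ with disjoint {zero} {suc i} (λ ()) eq eqᵢ
    ... | inj₁ e≤t = begin
      r + collapse s e μ t     ≡⟨ cong (r +_) (collapse-after s≤e μ e≤t) ⟩
      r + (μ s + μ t)          ≡⟨ solve 3 (λ r x y → r :+ (x :+ y) := x :+ (r :+ y))
                                    refl r (μ s) (μ t) ⟩
      μ s + (r + μ t)          ≤⟨ +-monoʳ-≤ _ (inside eqᵢ) ⟩
      μ s + μ (t + r)          ≡⟨ collapse-after s≤e μ (≤-trans e≤t (x≤x+y t (0≤p (suc i)))) ⟨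
      collapse s e μ (t + r)   ∎
      where r = p (suc i)
    ... | inj₂ t+r≤s = begin
      r + collapse s e μ t     ≡⟨ cong (r +_) (collapse-before s≤e μ
                                    (≤-trans (x≤x+y t (0≤p (suc i))) t+r≤s)) ⟩
      r + (μ t + μ e)          ≡⟨ +-assoc _ _ _ ⟨
      r + μ t + μ e            ≤⟨ +-monoˡ-≤ _ (inside eqᵢ) ⟩
      μ (t + r) + μ e          ≡⟨ collapse-before s≤e μ t+r≤s ⟨
      collapse s e μ (t + r)   ∎
      where r = p (suc i)
    -- `q` accumulates the lengths already removed, so `T - q` bounds the mass that is left; the
    -- interval from `s` to `e` takes at least `p zero` of it away.
    total′ : ∀ a b → collapse s e μ b + (q + p zero) ≤ collapse s e μ a + T
    total′ a b = cancel (μ s)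
      (solve 5 (λ u v q p m → ((u :+ v) :+ (q :+ p)) :+ m := (u :+ (v :+ q)) :+ (p :+ m))
        refl (μ (b ⊓ s)) (μ (b ⊔ e)) q (p zero) (μ s))
      (solve 4 (λ u v T m → (m :+ (u :+ T)) :+ v := ((u :+ v) :+ T) :+ m)
        refl (μ (a ⊓ s)) (μ (a ⊔ e)) T (μ s))
      (+-mono-≤ (+-mono-≤ (mono (x⊓y≤y b s)) (total (a ⊓ s) (b ⊔ e)))
                (≤-trans (inside eq) (mono (x≤y⊔x a e))))

-- The threshold inequality and its preservation

module Thresholds (ℝ : CompleteOrderedField) where
  open OrderedField ℝ

  -- t + (y - t) * G ≤ V, with the subtraction moved to the other side.
  Within : Carrier → Carrier → Carrier → Carrier → Set
  Within t V y G = t + y * G ≤ V + t * G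

  within-early : ∀ {t V y G} → y ≤ t → t ≤ V → 0# ≤ G → Within t V y G
  within-early y≤t t≤V 0≤G = +-mono-≤ t≤V (*-monoˡ-≤ 0≤G y≤t)

  within-raise : ∀ {t V V′ y G} → V ≤ V′ → Within t V y G → Within t V′ y G
  within-raise {t} {G = G} V≤V′ w = ≤-trans w (+-monoˡ-≤ (t * G) V≤V′)

  -- The load `x - t` is nonnegative, so `t + (x - t) * G` grows with the factor.
  within-weaken : ∀ {t V x y G H} → t ≤ x → y ≤ x → 0# ≤ G → G ≤ H →
                  Within t V x H → Within t V y G
  within-weaken {t} {V} {x} {y} {G} {H} t≤x y≤x 0≤G G≤H w = begin
    t + y * G ≤⟨ +-monoʳ-≤ t (*-monoˡ-≤ 0≤G y≤x) ⟩
    t + x * G ≤⟨ cancel (t * H + x * H)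
      (solve 4 (λ t x G H → (t :+ x :* G) :+ (t :* H :+ x :* H)
                         := (t :* H :+ x :* G) :+ (t :+ x :* H)) refl t x G H)
      (solve 5 (λ t V x G H → (t :* G :+ x :* H) :+ (V :+ t :* H)
                         := (V :+ t :* G) :+ (t :* H :+ x :* H)) refl t V x G H)
      (+-mono-≤ (rearrangement t≤x G≤H) w) ⟩
    V + t * G ∎

  -- As a function of `t`, `t + (y - t) * G` has slope `1# - G`, which is at most zero.
  within-later : ∀ {t t′ V y G} → t ≤ t′ → 1# ≤ G → Within t V y G → Within t′ V y G
  within-later {t} {t′} {V} {y} {G} t≤t′ 1≤G w = cancel (t + t * G)
    (solve 4 (λ t t′ y G → (t′ :+ y :* G) :+ (t :+ t :* G)
                        := (t :* G :+ t′ :* con 1) :+ (t :+ y :* G)) refl t t′ y G)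
    (solve 4 (λ t t′ V G → (t :* con 1 :+ t′ :* G) :+ (V :+ t :* G)
                        := (V :+ t′ :* G) :+ (t :+ t :* G)) refl t t′ V G)
    (+-mono-≤ (rearrangement t≤t′ 1≤G) w)

  -- A machine on which an admitted job does not fit forces the job to be so long
  -- that the machine may move down one place in the order.
  within-displaced : ∀ {t V d x p f F} → 0# ≤ f → f ≤ F → t ≤ x → d ≤ x + p →
                     Within t d x F → Within t V x F → Within t (V + f * p) x (f * F)
  within-displaced {t} {V} {d} {x} {p} {f} {F} 0≤f f≤F t≤x d≤x+p admitted w =
    -- Admission times `f` gives `f * F * (x - t) ≤ f * (x - t) + f * p`, and `w` with its factor
    -- lowered from `F` to `f` gives `t + f * (x - t) ≤ V`.
    cancel (f * t + f * x)
      (solve 4 (λ t x f F → (t :+ x :* (f :* F)) :+ (f :* t :+ f :* x)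
                         := f :* (t :+ x :* F) :+ (t :+ x :* f)) refl t x f F)
      (solve 6 (λ t V x p f F → f :* ((x :+ p) :+ t :* F) :+ (V :+ t :* f)
                         := ((V :+ f :* p) :+ t :* (f :* F)) :+ (f :* t :+ f :* x))
        refl t V x p f F)
      (+-mono-≤ (*-monoʳ-≤ 0≤f (≤-trans admitted (+-monoˡ-≤ (t * F) d≤x+p)))
                (within-weaken t≤x ≤-refl 0≤f f≤F w))

-- Admission, placement and the algorithm

module Algorithm (ℝ : CompleteOrderedField) (m : ℕ) .{{_ : NonZero m}}
  (ε : CompleteOrderedField.Carrier ℝ) (growth : OrderedField.GrowthFactor ℝ m ε) where
  open OrderedField ℝ
  open Packing ℝ
  open Thresholds ℝ
  open GrowthFactor growth
  open Job

  Completions : Set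
  Completions = Vector Carrier m

  -- Ranks start at 1 for the latest completion time; ties all get the larger rank.
  rank : Completions → Carrier → ℕ
  rank C y = count (λ k → y ≤? C k)

  factor : Completions → Carrier → Carrier
  factor C y = f ^ rank C y

  0≤factor : ∀ C y → 0# ≤ factor C y
  0≤factor C y = ^-nonNegative 0≤f (rank C y)

  1≤factor : ∀ C y → 1# ≤ factor C y
  1≤factor C y = ^-monoʳ-≤ 1≤f {0} {rank C y} ℕ.z≤n

  f≤factor : ∀ C k → f ≤ factor C (C k)
  f≤factor C k = subst (_≤ factor C (C k)) (*-identityʳ f)
    (^-monoʳ-≤ 1≤f (count-some (λ i → C k ≤? C i) {k} ≤-refl))

  -- The load is `C k - release j` without truncation at zero. Where it is not positive, the
  -- condition holds as soon as `release j ≤ deadline j`.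
  Admitted : Completions → Job → Set
  Admitted C j = ∀ k → Within (release j) (deadline j) (C k) (factor C (C k))

  Fits : Completions → Job → Fin m → Set
  Fits C j k = (release j ⊔ C k) + processing j ≤ deadline j

  Placement : Completions → Job → Fin m → Set
  Placement C j i = Admitted C j × Fits C j i × (∀ k → Fits C j k → C k ≤ C i)

  fits? : ∀ C j → Decidable (Fits C j)
  fits? C j k = _ ≤? _

  admitted-at? : ∀ C j → Decidable (λ k → Within (release j) (deadline j) (C k) (factor C (C k)))
  admitted-at? C j k = _ ≤? _

  placement? : ∀ C j → Dec (∃ (Placement C j))
  placement? C j = any? λ i → all? (admitted-at? C j)
    ×-dec (fits? C j i ×-dec all? λ k → fits? C j k →-dec C k ≤? C i)

  place : Completions → Job → Decision m
  place C j with placement? C j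
  ... | yes (i , _) = just (i , release j ⊔ C i)
  ... | no  _       = nothing

  place-just : ∀ {C j i s} → place C j ≡ just (i , s) → Placement C j i × s ≡ release j ⊔ C i
  place-just {C} {j} eq with placement? C j
  place-just refl | yes (i , placement) = placement , refl

  place-nothing : ∀ {C j} → place C j ≡ nothing → ¬ ∃ (Placement C j)
  place-nothing {C} {j} eq with placement? C j
  ... | no ¬placement = ¬placement

  update : Completions → Job → Decision m → Completions
  update C j (just (i , s)) = updateAt C i (const (s + processing j))
  update C j nothing        = C

  step : Completions → Job → Completions
  step C j = update C j (place C j)

  -- With the initial state as a parameter, the decisions on the tail of `j ∷ J` are by computation
  -- a run on `J` started from `step C j`, which is what the inductions use.
  assign : Completions → (J : List Job) → Schedule m J
  assign C J i = place (foldl step C (take (toℕ i) J)) (lookup J i)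

  -- Feasibility of the online schedule

  admissible-tail : ∀ {j J} → Admissible ε (j ∷ J) → Admissible ε J
  admissible-tail adm = record
    { release-nonNegative = λ i → release-nonNegative (suc i)
    ; processing-positive = λ i → processing-positive (suc i)
    ; slack               = λ i → slack (suc i)
    ; ordered             = λ i k rᵢ<rₖ → ℕ.s<s⁻¹ (ordered (suc i) (suc k) rᵢ<rₖ)
    }
    where open Admissible adm

  head-released-first : ∀ {j J} → Admissible ε (j ∷ J) → ∀ i → release j ≤ release (lookup J i)
  head-released-first {j} {J} adm i with release j ≤? release (lookup J i)
  ... | yes r₀≤rᵢ = r₀≤rᵢ
  ... | no  r₀≰rᵢ = ⊥-elim (ℕ.n≮0 (Admissible.ordered adm (suc i) zero
                      (≰⇒≥ r₀≰rᵢ , λ rᵢ≡r₀ → r₀≰rᵢ (≤-reflexive (sym rᵢ≡r₀)))))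

  step-occupied : ∀ {C j k s} → place C j ≡ just (k , s) → step C j k ≡ s + processing j
  step-occupied {C} {j} {k} eq rewrite eq = updateAt-updates k C

  step-increasing : ∀ C {j} → 0# ≤ processing j → ∀ k → C k ≤ step C j k
  step-increasing C {j} 0≤p k with place C j in eq
  ... | nothing = ≤-refl
  ... | just (i , s) with k ≟ᶠ i
  ...   | no  k≢i  = ≤-reflexive (sym (updateAt-minimal k i C k≢i))
  ...   | yes refl = begin
    C k                                           ≤⟨ x≤y⊔x (release j) (C k) ⟩
    release j ⊔ C k                               ≡⟨ proj₂ (place-just {C} {j} eq) ⟨
    s                                             ≤⟨ x≤x+y s 0≤p ⟩
    s + processing j                              ≡⟨ updateAt-updates k C ⟨
    updateAt C k (const (s + processing j)) k     ∎

  assign-after : ∀ C J → Admissible ε J → ∀ {i k s} → assign C J i ≡ just (k , s) → C k ≤ s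
  assign-after C (j ∷ J) adm {zero} {k} eq with place-just {C} {j} eq
  ... | _ , refl = x≤y⊔x (release j) (C k)
  assign-after C (j ∷ J) adm {suc i} {k} eq =
    ≤-trans (step-increasing C (proj₁ (Admissible.processing-positive adm zero)) k)
            (assign-after (step C j) J (admissible-tail adm) eq)

  -- If the earlier job is the head, its end is the completion time of `k` in the next state, and
  -- `assign-after` applies from there.
  assign-consecutive : ∀ C J → Admissible ε J → ∀ {i i′ k s s′} → i <ᶠ i′ →
    assign C J i ≡ just (k , s) → assign C J i′ ≡ just (k , s′) →
    s + processing (lookup J i) ≤ s′
  assign-consecutive C (j ∷ J) adm {zero} {suc i′} {s′ = s′} _ eq eq′ =
    subst (_≤ s′) (step-occupied {C} {j} eq)
      (assign-after (step C j) J (admissible-tail adm) eq′)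
  assign-consecutive C (j ∷ J) adm {suc i} {suc i′} i<i′ eq eq′ =
    assign-consecutive (step C j) J (admissible-tail adm) (ℕ.s<s⁻¹ i<i′) eq eq′

  <⇒≱ : ∀ {x y} → x < y → ¬ (y ≤ x)
  <⇒≱ (x≤y , x≢y) y≤x = x≢y (≤-antisym x≤y y≤x)

  assign-feasible : ∀ C {J} → Admissible ε J → Feasible J (assign C J)
  assign-feasible C {J} adm = record
    { starts-after-release  = λ {i} {k} eq → subst (release (lookup J i) ≤_)
        (sym (proj₂ (place-just {state i} eq))) (x≤x⊔y _ _)
    ; completes-by-deadline = λ {i} eq → subst (λ s → s + processing (lookup J i) ≤ _)
        (sym (proj₂ (place-just {state i} eq))) (proj₁ (proj₂ (proj₁ (place-just {state i} eq))))
    ; one-job-at-a-time     = λ {i} {i′} → exclusive {i} {i′}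
    }
    where
    state : Fin (length J) → Completions
    state i = foldl step C (take (toℕ i) J)
    clash : ∀ {i i′ k t} → i <ᶠ i′ → RunsAt J (assign C J) i k t →
              ¬ RunsAt J (assign C J) i′ k t
    clash i<i′ (s , eq , _ , t<s+p) (s′ , eq′ , s′≤t , _) =
      <⇒≱ t<s+p (≤-trans (assign-consecutive C J adm i<i′ eq eq′) s′≤t)
    compare : ∀ {i i′ k t} → Tri (i <ᶠ i′) (i ≡ i′) (i′ <ᶠ i) →
              RunsAt J (assign C J) i k t → RunsAt J (assign C J) i′ k t → i ≡ i′
    compare {i} {i′} {k} {t} (tri< i<i′ _ _) run run′ =
      ⊥-elim (clash {i} {i′} {k} {t} i<i′ run run′)
    compare (tri≈ _ i≡i′ _) _ _ = i≡i′
    compare {i} {i′} {k} {t} (tri> _ _ i′<i) run run′ =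
      ⊥-elim (clash {i′} {i} {k} {t} i′<i run′ run)
    exclusive : ∀ {i i′ k t} → RunsAt J (assign C J) i k t → RunsAt J (assign C J) i′ k t → i ≡ i′
    exclusive {i} {i′} {k} {t} = compare {i} {i′} {k} {t} (<-cmp i i′)

  algorithm : OnlineAlgorithm m ε
  algorithm = record
    { decide   = λ past j → place (foldl step (replicate m 0#) past) j
    ; feasible = assign-feasible (replicate m 0#)
    }

  least-loaded : ∀ {n} .{{_ : NonZero n}} (C : Vector Carrier n) → ∃[ i ] (∀ k → C i ≤ C k)
  least-loaded {ℕ.suc n} C
    with minimum {_≲_ = λ i k → C i ≤ C k} (λ i k → ≤-total (C i) (C k)) ≤-trans (λ _ → yes tt)
  ... | inj₁ none            = ⊥-elim (none zero tt)
  ... | inj₂ (i , _ , least) = i , λ k → least k tt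

  fits-intro : ∀ {C j k} → release j + processing j ≤ deadline j →
               C k + processing j ≤ deadline j → Fits C j k
  fits-intro {C} {j} {k} r+p≤d C+p≤d with ≤-total (release j) (C k)
  ... | inj₁ r≤C = subst (λ s → s + processing j ≤ deadline j) (sym (x≤y⇒x⊔y≈y r≤C)) C+p≤d
  ... | inj₂ C≤r = subst (λ s → s + processing j ≤ deadline j) (sym (x≤y⇒y⊔x≈y C≤r)) r+p≤d

  record Slack (j : Job) : Set where
    field
      processing-positive : 0# < processing j
      slack               : release j + (1# + ε) * processing j ≤ deadline j

    fits-empty : release j + processing j ≤ deadline j
    fits-empty = begin
      release j + processing j
        ≤⟨ x≤x+y _ (*-nonNegative (proj₁ 0<ε) (proj₁ processing-positive)) ⟩
      release j + processing j + ε * processing j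
        ≡⟨ solve 3 (λ r p ε → (r :+ p) :+ ε :* p := r :+ (con 1 :+ ε) :* p) refl _ _ ε ⟩
      release j + (1# + ε) * processing j
        ≤⟨ slack ⟩
      deadline j ∎

    misfit : ∀ {C k} → ¬ Fits C j k → deadline j ≤ C k + processing j
    misfit {C} {k} ¬fits = ≰⇒≥ (¬fits ∘ fits-intro {C} {j} {k} fits-empty)

    -- On the least loaded machine the threshold factor is f ^ m ≡ (1# + ε) / ε,
    -- so that admission and slack together leave room for the job.
    admitted⇒fits : ∀ {C} → Admitted C j → ∃ (Fits C j)
    admitted⇒fits {C} admitted = k , fits-intro {C} fits-empty
      -- With `l = C k - r`, `ε*within` says `(1# + ε) * l ≤ ε * (d - r)` and slack says
      -- `(1# + ε) * p ≤ d - r`; their sum, divided by `1# + ε`, is `l + p ≤ d - r`.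
      (*-cancelˡ-≤ 0<1+ε (cancel (r + ε * r)
        (solve 4 (λ ε r p c → (con 1 :+ ε) :* (c :+ p) :+ (r :+ ε :* r)
                           := (ε :* r :+ c :* (con 1 :+ ε)) :+ (r :+ (con 1 :+ ε) :* p))
          refl ε r p (C k))
        (solve 3 (λ ε r d → (ε :* d :+ r :* (con 1 :+ ε)) :+ d
                         := (con 1 :+ ε) :* d :+ (r :+ ε :* r)) refl ε r d)
        (+-mono-≤ ε*within slack)))
      where
      r = release j
      p = processing j
      d = deadline j
      k = proj₁ (least-loaded C)
      within : Within r d (C k) (f ^ m)
      -- All machines complete no earlier than `k`, so its rank is `m`.
      within = subst (λ n → Within r d (C k) (f ^ n))
        (count-all (λ i → C k ≤? C i) (proj₂ (least-loaded C))) (admitted k)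
      ε*[x+y*f^m] : ∀ x y → ε * (x + y * f ^ m) ≡ ε * x + y * (1# + ε)
      ε*[x+y*f^m] x y = trans
        (solve 4 (λ ε x y F → ε :* (x :+ y :* F) := ε :* x :+ y :* (ε :* F)) refl ε x y (f ^ m))
        (cong (λ z → ε * x + y * z) ε*f^m≡1+ε)
      ε*within : ε * r + C k * (1# + ε) ≤ ε * d + r * (1# + ε)
      ε*within = subst₂ _≤_ (ε*[x+y*f^m] r (C k)) (ε*[x+y*f^m] d r)
        (*-monoʳ-≤ (proj₁ 0<ε) within)

    admitted⇒placement : ∀ {C} → Admitted C j → ∃ (Placement C j)
    admitted⇒placement {C} admitted
      -- The order is reversed: the minimum is the fitting machine with the latest completion time.
      with minimum {_≲_ = λ i k → C k ≤ C i} (λ i k → ≤-total (C k) (C i)) (flip ≤-trans)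
             (fits? C j)
    ... | inj₁ none              = ⊥-elim (none _ (proj₂ (admitted⇒fits admitted)))
    ... | inj₂ (i , fits , most) = i , admitted , fits , most

  open Slack using (misfit; fits-empty; admitted⇒placement)

  admissible⇒slack : ∀ {J} → Admissible ε J → ∀ i → Slack (lookup J i)
  admissible⇒slack {J} adm i = record
    { processing-positive = Admissible.processing-positive adm i
    ; slack = subst (release (lookup J i) + (1# + ε) * processing (lookup J i) ≤_)
                (x+[y-x]≡y _ _) (+-monoʳ-≤ _ (Admissible.slack adm i))
    }

  -- The invariant relating loads to the virtual machine

  Bounded : Carrier → Carrier → Completions → Set
  Bounded t V C = ∀ k → Within t V (C k) (factor C (C k))

  -- As admission implies placement, a rejected job violates the threshold of some machine; the
  -- invariant puts that threshold below `V`.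
  rejected⇒deadline≤ : ∀ {C j V} → Slack j → Bounded (release j) V C →
                       place C j ≡ nothing → deadline j ≤ V
  rejected⇒deadline≤ {C} {j} {V} slack bounded eq
    with ¬∀⟶∃¬ m _ (admitted-at? C j) (place-nothing {C} {j} eq ∘ admitted⇒placement slack)
  ... | k , ¬admitted = cancel (release j * factor C (C k)) refl refl
    (≤-trans (≰⇒≥ ¬admitted) (bounded k))

  accepted : Job → Decision m → Carrier
  accepted j = maybe′ (λ _ → processing j) 0#

  -- A machine later than `i` could not take the job and may therefore fall by one rank. A machine
  -- no later than `i` keeps its bound. The new completion time inherits its bound from the next
  -- later machine or, if there is none, from the start of the job.
  placed-bounded : ∀ {C j i V} → Slack j → release j ≤ V → Placement C j i →
                   Bounded (release j) V C →
                   Bounded (release j) (V + f * processing j)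
                     (updateAt C i (const ((release j ⊔ C i) + processing j)))
  placed-bounded {C} {j} {i} {V} slack r≤V (admitted , fits , most) bounded = bounded′
    where
    r = release j
    p = processing j
    s = r ⊔ C i
    e = s + p
    C′ = updateAt C i (const e)
    V′ = V + f * p

    0<p : 0# < p
    0<p = Slack.processing-positive slack

    V≤V′ : V ≤ V′
    V≤V′ = x≤x+y V (*-nonNegative 0≤f (proj₁ 0<p))

    other : ∀ {k} → k ≢ i → C′ k ≡ C k
    other {k} k≢i = updateAt-minimal k i C k≢i

    -- Only machine `i` has changed, so at most one more machine is counted.
    rank-suc : ∀ {x y} → (∀ k → x ≤ C k → y ≤ C k) → rank C′ x ℕ.≤ ℕ.suc (rank C y)
    rank-suc {x} {y} x⇒y = count-mono-except (λ k → x ≤? C′ k) (λ k → y ≤? C k) i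
      λ k k≢i x≤C′k → x⇒y k (subst (x ≤_) (other k≢i) x≤C′k)

    -- No old completion time lies in `[ y , C k )`, so `y` ranks at most one place below the old
    -- place of `k`, and `within-displaced` at `k` pays for that place.
    displaced : ∀ {k y} → ¬ (C k ≤ C i) → y ≤ C k → (∀ l → y ≤ C l → C k ≤ C l) →
                Within r V′ y (factor C′ y)
    displaced {k} {y} Ck≰Ci y≤Ck above = within-weaken r≤Ck y≤Ck (0≤factor C′ y)
      (^-monoʳ-≤ 1≤f (rank-suc above))
      (within-displaced 0≤f (f≤factor C k) r≤Ck d≤Ck+p (admitted k) (bounded k))
      where
      d≤Ck+p : deadline j ≤ C k + p
      d≤Ck+p = misfit slack {C} (Ck≰Ci ∘ most k)
      r≤Ck : r ≤ C k
      r≤Ck = cancel p refl refl (≤-trans (fits-empty slack) d≤Ck+p)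

    at-other : ∀ k → Within r V′ (C k) (factor C′ (C k))
    at-other k with ≤-total (C k) r | C k ≤? C i
    ... | _         | no  Ck≰Ci = displaced {k} Ck≰Ci ≤-refl λ _ Ck≤Cl → Ck≤Cl
    ... | inj₁ Ck≤r | yes _     = within-early Ck≤r (≤-trans r≤V V≤V′) (0≤factor C′ (C k))
    -- Machine `i` was already counted in the rank of `C k`, so its update does not raise that rank.
    ... | inj₂ r≤Ck | yes Ck≤Ci = within-weaken r≤Ck ≤-refl (0≤factor C′ (C k))
      (^-monoʳ-≤ 1≤f (count-mono (λ l → C k ≤? C′ l) (λ l → C k ≤? C l) below))
      (within-raise V≤V′ (bounded k))
      where
      below : ∀ l → C k ≤ C′ l → C k ≤ C l
      below l Ck≤C′l with l ≟ᶠ i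
      ... | yes refl = Ck≤Ci
      ... | no  l≢i  = subst (C k ≤_) (other l≢i) Ck≤C′l

    start-within : Within r V s f
    start-within with ≤-total r (C i)
    ... | inj₁ r≤Ci = subst (λ x → Within r V x f) (sym (x≤y⇒x⊔y≈y r≤Ci))
                        (within-weaken r≤Ci ≤-refl 0≤f (f≤factor C i) (bounded i))
    ... | inj₂ Ci≤r = subst (λ x → Within r V x f) (sym (x≤y⇒y⊔x≈y Ci≤r))
                        (within-early ≤-refl r≤V 0≤f)

    s≤e : s ≤ e
    s≤e = x≤x+y s (proj₁ 0<p)

    at-placed : Within r V′ e (factor C′ e)
    at-placed with minimum {_≲_ = λ k l → C k ≤ C l} (λ k l → ≤-total (C k) (C l)) ≤-trans
                     (λ k → e ≤? C k)
    ... | inj₂ (k , e≤Ck , least) = displaced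
      (λ Ck≤Ci → x+δ≰x 0<p (≤-trans e≤Ck (≤-trans Ck≤Ci (x≤y⊔x r (C i))))) e≤Ck least
    -- Now `e` is latest and has rank at most 1, so the load `p` added after `s` costs `f * p`,
    -- exactly the growth of `V`.
    ... | inj₁ none = within-weaken (≤-trans (x≤x⊔y r (C i)) s≤e) ≤-refl (0≤factor C′ e)
      (^-monoʳ-≤ 1≤f {k = 1} (subst (λ n → rank C′ e ℕ.≤ ℕ.suc n)
        (count-none (λ k → e ≤? C k) none) (rank-suc λ _ e≤Ck → e≤Ck)))
      (subst₂ _≤_
        (solve 4 (λ r s p f → (r :+ s :* f) :+ p :* f := r :+ (s :+ p) :* (f :* con 1))
          refl r s p f)
        (solve 4 (λ r V p f → (V :+ r :* f) :+ p :* f := (V :+ f :* p) :+ r :* (f :* con 1))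
          refl r V p f)
        (+-monoˡ-≤ (p * f) start-within))

    bounded′ : Bounded r V′ C′
    bounded′ k with k ≟ᶠ i
    ... | yes refl =
      subst (λ y → Within r V′ y (factor C′ y)) (sym (updateAt-updates k C)) at-placed
    ... | no  k≢i  =
      subst (λ y → Within r V′ y (factor C′ y)) (sym (other k≢i)) (at-other k)

  step-bounded : ∀ {C j V} → Slack j → release j ≤ V → Bounded (release j) V C →
                 Bounded (release j) (V + f * accepted j (place C j)) (step C j)
  step-bounded {C} {j} {V} slack r≤V bounded with place C j in eq
  ... | nothing = λ k → within-raise (x≤x+y V (*-nonNegative 0≤f ≤-refl)) (bounded k)
  ... | just (i , s) with place-just {C} {j} eq
  ...   | placement , refl = placed-bounded slack r≤V placement bounded

  accepted-nonNegative : ∀ {j} → Slack j → ∀ δ → 0# ≤ accepted j δ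
  accepted-nonNegative slack (just _) = proj₁ (Slack.processing-positive slack)
  accepted-nonNegative slack nothing  = ≤-refl

  -- Covering the windows of rejected jobs by busy time

  -- `μ` stands for busy time of the virtual machine accumulated before `J`, `ν` for the busy time
  -- added by `J`; the window of a rejected job may meet both.
  record Covering (C : Completions) (J : List Job) (μ : Carrier → Carrier) : Set where
    field
      ν       : Carrier → Carrier
      mono    : Monotone ν
      total   : ∀ a b → ν b ≤ ν a + f * load J (assign C J)
      windows : ∀ i → assign C J i ≡ nothing →
                Covers (release (lookup J i)) (deadline (lookup J i)) (λ x → μ x + ν x)

  -- Induction along the sequence with `μ` covering `[ t , V ]`. An accepted job appends a busy
  -- interval of `f` times its length; a rejected one has its deadline at or before the current idle
  -- time, so its window is covered already.
  covering : ∀ J {C t V μ} → Admissible ε J → (∀ i → t ≤ release (lookup J i)) → t ≤ V →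
             Bounded t V C → Monotone μ → Covers t V μ → Covering C J μ
  covering [] adm t≤ t≤V bounded mono cov = record
    { ν       = const 0#
    ; mono    = λ _ → ≤-refl
    ; total   = λ _ _ → x≤x+y 0# (*-nonNegative 0≤f ≤-refl)
    ; windows = λ ()
    }
  covering (j ∷ J) {C} {t} {V} {μ} adm t≤ t≤V bounded mono cov = record
    { ν       = λ x → κ x + ν x
    ; mono    = λ x≤y → +-mono-≤ (clip-mono V₁ V₂ x≤y) (ν-mono x≤y)
    ; total   = λ a b → begin
        κ b + ν b                       ≤⟨ +-mono-≤ (clip-bounded V₁≤V₂ ≤-refl a b) (total a b) ⟩
        κ a + f * q + (ν a + f * L)     ≡⟨ solve 5 (λ k n f q L → (k :+ f :* q) :+ (n :+ f :* L)
                                             := (k :+ n) :+ f :* (q :+ L)) refl (κ a) (ν a) f q L ⟩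
        κ a + ν a + f * (q + L)         ∎
    ; windows = λ where
        zero eq → covers-+ {μ = μ} (covers-shrink {μ = μ} ≤-refl
                      (rejected⇒deadline≤ slack bounded₁ eq) cov₁)
                    (λ x≤y → +-mono-≤ (clip-mono V₁ V₂ x≤y) (ν-mono x≤y))
        (suc i) eq → covers-cong (λ x → +-assoc (μ x) (κ x) (ν x)) (windows i eq)
    }
    where
    r = release j
    q = accepted j (place C j)
    L = load J (assign (step C j) J)
    -- A virtual machine that is idle before `r` starts its next job at `r`.
    V₁ = V ⊔ r
    V₂ = V₁ + f * q
    κ = clip V₁ V₂
    slack : Slack j
    slack = admissible⇒slack adm zero
    V₁≤V₂ : V₁ ≤ V₂
    V₁≤V₂ = x≤x+y V₁ (*-nonNegative 0≤f (accepted-nonNegative slack (place C j)))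
    bounded₁ : Bounded r V₁ C
    bounded₁ k = within-raise (x≤x⊔y V r) (within-later (t≤ zero) (1≤factor C (C k)) (bounded k))
    cov₁ : Covers r V₁ μ
    cov₁ with ≤-total V r
    ... | inj₁ V≤r = covers-point {μ = μ} (≤-reflexive (x≤y⇒x⊔y≈y V≤r))
    ... | inj₂ r≤V = covers-shrink {μ = μ} (t≤ zero) (≤-reflexive (x≤y⇒y⊔x≈y r≤V)) cov
    cov₂ : Covers r V₂ (λ x → μ x + κ x)
    cov₂ = covers-glue {μ = λ x → μ x + κ x} (covers-+ {μ = μ} cov₁ (clip-mono V₁ V₂))
      (covers-cong (λ x → +-comm (κ x) (μ x)) (covers-+ {μ = κ} clip-covers mono))
    rest : Covering (step C j) J (λ x → μ x + κ x)
    rest = covering J (admissible-tail adm) (head-released-first adm)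
      (≤-trans (x≤y⊔x V r) V₁≤V₂) (step-bounded slack (x≤y⊔x V r) bounded₁)
      (λ x≤y → +-mono-≤ (mono x≤y) (clip-mono V₁ V₂ x≤y)) cov₂
    open Covering rest renaming (mono to ν-mono)

  -- Offline jobs that the algorithm rejects

  -- `α` is the online and `ω` the offline decision on the same job; the result is the offline start
  -- if only `ω` accepts, and does so on machine `k`.
  missed : Decision m → Decision m → Fin m → Maybe Carrier
  missed (just _) _       k = nothing
  missed nothing  nothing k = nothing
  missed nothing  (just (i , s)) k with k ≟ᶠ i
  ... | yes _ = just s
  ... | no  _ = nothing

  missed-just : ∀ α ω {k s} → missed α ω k ≡ just s → α ≡ nothing × ω ≡ just (k , s)
  missed-just nothing (just (i , s)) {k} eq with k ≟ᶠ i
  missed-just nothing (just (i , s)) {k} refl | yes refl = refl , refl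

  missed-refl : ∀ k s → missed nothing (just (k , s)) k ≡ just s
  missed-refl k s with k ≟ᶠ k
  ... | yes _  = refl
  ... | no k≢k = ⊥-elim (k≢k refl)

  missed-nonNegative : ∀ {p : Carrier} → 0# ≤ p → ∀ α ω k →
                       0# ≤ maybe′ (λ _ → p) 0# (missed α ω k)
  missed-nonNegative 0≤p α ω k with missed α ω k
  ... | just _  = 0≤p
  ... | nothing = ≤-refl

  accepted-or-missed : ∀ {p : Carrier} → 0# ≤ p → ∀ (α ω : Decision m) →
    maybe′ (λ _ → p) 0# ω ≤
    maybe′ (λ _ → p) 0# α + sum (λ k → maybe′ (λ _ → p) 0# (missed α ω k))
  accepted-or-missed {p} 0≤p α@(just _) ω@(just _) =
    x≤x+y p (sum-nonNegative (missed-nonNegative 0≤p α ω))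
  accepted-or-missed {p} 0≤p α@(just _) nothing =
    ≤-trans 0≤p (x≤x+y p (sum-nonNegative (missed-nonNegative 0≤p α nothing)))
  accepted-or-missed {p} 0≤p nothing nothing =
    x≤x+y 0# (sum-nonNegative (missed-nonNegative 0≤p nothing nothing))
  accepted-or-missed {p} 0≤p nothing ω@(just (i , s)) = begin
    p                   ≡⟨ cong (maybe′ (λ _ → p) 0#) (missed-refl i s) ⟨
    missed-value i      ≤⟨ term≤sum (missed-nonNegative 0≤p nothing ω) i ⟩
    sum missed-value    ≡⟨ +-identityˡ _ ⟨
    0# + sum missed-value ∎
    where
    missed-value : Fin m → Carrier
    missed-value k = maybe′ (λ _ → p) 0# (missed nothing ω k)

  x<x+y : ∀ x {y} → 0# < y → x < x + y
  x<x+y x 0<y = x≤x+y x (proj₁ 0<y) , λ x≡x+y → x+δ≰x 0<y (≤-reflexive (sym x≡x+y))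

  -- Otherwise both jobs would run at time `t`, the start of the second.
  feasible-consecutive : ∀ {J} {S : Schedule m J} → Admissible ε J → Feasible J S →
    ∀ {i j k s t} → i ≢ j →
    S i ≡ just (k , s) → S j ≡ just (k , t) → s ≤ t → s + processing (lookup J i) ≤ t
  feasible-consecutive {J} adm feas {i} {j} {s = s} {t} i≢j eqᵢ eqⱼ s≤t
    with s + processing (lookup J i) ≤? t
  ... | yes s+p≤t = s+p≤t
  ... | no  s+p≰t = ⊥-elim (i≢j (Feasible.one-job-at-a-time feas
    (s , eqᵢ , s≤t , ≰⇒≥ s+p≰t , λ t≡s+p → s+p≰t (≤-reflexive (sym t≡s+p)))
    (t , eqⱼ , ≤-refl , x<x+y t (Admissible.processing-positive adm j))))

  feasible-disjoint : ∀ {J} {S : Schedule m J} → Admissible ε J → Feasible J S →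
    ∀ {i j k s t} → i ≢ j →
    S i ≡ just (k , s) → S j ≡ just (k , t) →
    s + processing (lookup J i) ≤ t ⊎ t + processing (lookup J j) ≤ s
  feasible-disjoint adm feas {s = s} {t} i≢j eqᵢ eqⱼ with ≤-total s t
  ... | inj₁ s≤t = inj₁ (feasible-consecutive adm feas i≢j eqᵢ eqⱼ s≤t)
  ... | inj₂ t≤s = inj₂ (feasible-consecutive adm feas (≢-sym i≢j) eqⱼ eqᵢ t≤s)

  -- The competitive ratio

  open OnlineAlgorithm algorithm using (schedule; ALG)

  -- The missed jobs on `k` occupy disjoint intervals inside windows of rejected jobs, where `ν`
  -- dominates length. As `ν` has total mass at most `f * ALG J`, `packing` applies.
  missed-load : ∀ {J} {S : Schedule m J} → Admissible ε J → Feasible J S → ∀ k →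
    sum (λ i → maybe′ (λ _ → processing (lookup J i)) 0# (missed (schedule J i) (S i) k))
      ≤ f * ALG J
  missed-load {J} {S} adm feas k = subst (_≤ f * ALG J) (+-identityˡ _)
    (packing (λ i → processing (lookup J i)) (λ i → missed (schedule J i) (S i) k)
      {λ x → 0# + ν x} {0#}
      (λ i → proj₁ (Admissible.processing-positive adm i))
      (λ {i} {j} i≢j eqᵢ eqⱼ → feasible-disjoint adm feas i≢j
        (proj₂ (missed-just (schedule J i) (S i) eqᵢ))
        (proj₂ (missed-just (schedule J j) (S j) eqⱼ)))
      (λ x≤y → +-monoʳ-≤ 0# (mono x≤y))
      inside
      (λ a b → subst₂ _≤_ (solve 1 (λ x → x := (con 0 :+ x) :+ con 0) refl (ν b))
        (cong (_+ f * ALG J) (sym (+-identityˡ (ν a)))) (total a b)))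
    where
    C₀ : Completions
    C₀ = replicate m 0#
    whole : Covering C₀ J (const 0#)
    -- At time zero all machines and the virtual one are idle: `t` and `V` are `0#`, and `μ` is the
    -- zero measure.
    whole = covering J adm (Admissible.release-nonNegative adm) ≤-refl
      (λ _ → within-early ≤-refl ≤-refl (0≤factor C₀ 0#))
      (λ _ → ≤-refl) (covers-point {μ = const 0#} ≤-refl)
    open Covering whole
    inside : ∀ {i s} → missed (schedule J i) (S i) k ≡ just s →
             processing (lookup J i) + (0# + ν s) ≤ 0# + ν (s + processing (lookup J i))
    inside {i} {s} eq = cancel s
      (solve 3 (λ p n s → (p :+ n) :+ s := (s :+ p) :+ n) refl p (0# + ν s) s)
      (+-comm s (0# + ν (s + p)))
      (windows i (proj₁ split) (Feasible.starts-after-release feas (proj₂ split))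
        (x≤x+y s (proj₁ (Admissible.processing-positive adm i)))
        (Feasible.completes-by-deadline feas (proj₂ split)))
      where
      p = processing (lookup J i)
      split = missed-just (schedule J i) (S i) eq

  -- `OPT` is a least upper bound, so bounding each feasible schedule suffices. Its jobs are
  -- accepted online, contributing at most `ALG J`, or missed, contributing at most `f * ALG J` per
  -- machine.
  competitive : StrictCompetitiveRatioAtMost algorithm (m · f + 1#)
  competitive J adm = proj₂ (proj₂ (OPT-supremum m adm)) bound
    where
    p : Fin (length J) → Carrier
    p i = processing (lookup J i)
    bound : UpperBound (OfflineValue m J) ((m · f + 1#) * ALG J)
    bound (S , feas , refl) = begin
      load J S
        ≤⟨ sum-mono-≤ (λ i → accepted-or-missed (proj₁ (Admissible.processing-positive adm i))
                               (schedule J i) (S i)) ⟩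
      sum (λ i → a i + sum (λ k → w i k))   ≡⟨ ∑-distrib-+ a (λ i → sum (w i)) ⟩
      ALG J + sum (λ i → sum (w i))         ≡⟨ cong (ALG J +_) (∑-comm w) ⟩
      ALG J + sum (λ k → sum (λ i → w i k)) ≤⟨ +-monoʳ-≤ _ (sum-mono-≤ (missed-load adm feas)) ⟩
      ALG J + sum (replicate m (f * ALG J)) ≡⟨ cong (ALG J +_) (sum-replicate m) ⟩
      ALG J + m · (f * ALG J)               ≡⟨ cong (ALG J +_) (×-assoc-* m f (ALG J)) ⟨
      ALG J + m · f * ALG J                 ≡⟨ solve 2 (λ a c → a :+ c :* a := (c :+ con 1) :* a)
                                                 refl (ALG J) (m · f) ⟩
      (m · f + 1#) * ALG J                  ∎
      where
      a : Fin (length J) → Carrier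
      a i = maybe′ (λ _ → p i) 0# (schedule J i)
      w : Fin (length J) → Fin m → Carrier
      w i k = maybe′ (λ _ → p i) 0# (missed (schedule J i) (S i) k)

theorem4 : (ℝ : CompleteOrderedField) →
    let open CompleteOrderedField ℝ
        open Roots ℝ using (root)
        open Scheduling ℝ
    in
    (m : ℕ) .{{_ : NonZero m}} (ε : Carrier) → 0# < ε → ε ≤ 1# →
    ∃[ A ] StrictCompetitiveRatioAtMost {m} {ε} A (m · root m ((1# + ε) / ε) + 1#)
theorem4 ℝ m ε 0<ε _ = algorithm , competitive
  where open Algorithm ℝ m ε (OrderedField.root-growthFactor ℝ m 0<ε)
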